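{- For all integers $n\ge 1$ and $k\ge 2$, $$d_k(n+1)=d_{k-2}(n)+3\,d_{k-1}(n)+d_k(n)+2\,s_k(n).$$
   Context: For $n\ge 1$, the $2\times n$ board consists of $2n$ unit squares $x_0,\dots,x_{2n-1}$ arranged in 2 rows and $n$ columns, labeled with the top row first (left to right, $x_0,\dots,x_{n-1}$... ) — more precisely, labeled so that $x_{2i}$ and $x_{2i+1}$ form column $i$ ($i=0,\dots,n-1$), with $x_{2n-2},x_{2n-1}$ the two squares of the rightmost column. Two squares are adjacent iff they share an edge. A piece is a nonempty set of squares that is connected under adjacency. A division of the board into $k$ pieces is a partition of the set of all $2n$ squares into exactly $k$ pieces. $d_k(n)$ denotes the number of divisions of the $2\times n$ board into $k$ pieces (so $d_0(n)=0$, $d_1(n)=1$). $s_k(n)$ denotes the number of such divisions in which the two squares of the rightmost column lie in different pieces. -}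

module Defs where

open import Data.Nat using (ℕ; zero; suc; _*_; _/_; _%_; ∣_-_∣)
import Data.Nat.Properties as ℕ
open import Data.Fin using (Fin; zero; suc; toℕ)
import Data.Fin.Properties as Fin
open import Data.Fin.Subset using (Subset; inside; outside; _∈_; _∩_; Nonempty; Empty)
open import Data.Fin.Subset.Properties using (_∈?_; nonempty?)
open import Data.List using (List; []; _∷_; _++_; map; length; filter)
open import Data.List.Relation.Unary.All as All using (All)
open import Data.List.Relation.Unary.Any as Any using (Any)
open import Data.List.Relation.Unary.AllPairs as AllPairs using (AllPairs)
open import Data.Product using (_×_; _,_; ∃)
open import Data.Sum using (_⊎_; inj₁; inj₂)
open import Data.Vec using ([]; _∷_)
open import Function using (_∘_)
open import Level using (0ℓ)
open import Relation.Binary.Core using (Rel)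
open import Relation.Binary.Definitions using (Decidable)
open import Relation.Binary.PropositionalEquality using (_≡_; _≢_)
open import Relation.Binary.Construct.Closure.ReflexiveTransitive using (Star; ε; _◅_; _◅◅_)
open import Relation.Nullary using (¬_; Dec; yes; ¬?; _×-dec_; _⊎-dec_; _→-dec_)
open import Relation.Nullary.Decidable using (map′)

-- The element i of Fin (n * 2) is the square xᵢ of the 2 × n board, so
-- x₂ᵢ and x₂ᵢ₊₁ are the two squares of column i.

Square : ℕ → Set
Square n = Fin (n * 2)

module _ {n : ℕ} where

  column row : Square n → ℕ
  column x = toℕ x / 2
  row    x = toℕ x % 2

  -- Two distinct unit cells of a grid share an edge exactly when they are
  -- consecutive in a common row or in a common column.

  Adjacent : Rel (Square n) 0ℓ
  Adjacent x y = (row x ≡ row y × ∣ column x - column y ∣ ≡ 1)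
               ⊎ (column x ≡ column y × ∣ row x - row y ∣ ≡ 1)

  StepIn : Subset (n * 2) → Rel (Square n) 0ℓ
  StepIn S x y = x ∈ S × y ∈ S × Adjacent x y

  Connected : Subset (n * 2) → Set
  Connected S = ∀ x y → x ∈ S → y ∈ S → Star (StepIn S) x y

  Piece : Subset (n * 2) → Set
  Piece S = Nonempty S × Connected S

  Disjoint : Rel (Subset (n * 2)) 0ℓ
  Disjoint S T = Empty (S ∩ T)

  Division : List (Subset (n * 2)) → Set
  Division F = All Piece F × AllPairs Disjoint F × (∀ x → Any (x ∈_) F)

  DivisionInto : ℕ → List (Subset (n * 2)) → Set
  DivisionInto k F = length F ≡ k × Division F

  Rightmost : Square n → Set
  Rightmost x = suc (column x) ≡ n

  RightmostApart : List (Subset (n * 2)) → Set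
  RightmostApart F = ∀ x y → Rightmost x → Rightmost y → x ≢ y →
                     ¬ Any (λ S → x ∈ S × y ∈ S) F

-- Reachability in a finite graph is decided by eliminating vertex zero.

module _ {m : ℕ} (R : Rel (Fin (suc m)) 0ℓ) where

  Bypass : Rel (Fin m) 0ℓ
  Bypass i j = R (suc i) (suc j) ⊎ (R (suc i) zero × R zero (suc j))

  Bypass⇒Star : ∀ {i j} → Star Bypass i j → Star R (suc i) (suc j)
  Bypass⇒Star ε                    = ε
  Bypass⇒Star (inj₁ r       ◅ rs) = r ◅ Bypass⇒Star rs
  Bypass⇒Star (inj₂ (r , s) ◅ rs) = r ◅ s ◅ Bypass⇒Star rs

  mutual
    Star⇒Bypass : ∀ {i j} → Star R (suc i) (suc j) → Star Bypass i j
    Star⇒Bypass ε                      = ε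
    Star⇒Bypass (_◅_ {j = suc _} r rs) = inj₁ r ◅ Star⇒Bypass rs
    Star⇒Bypass (_◅_ {j = zero}  r rs) with fromZero rs
    ... | _ , s , ss = inj₂ (r , s) ◅ ss

    fromZero : ∀ {j} → Star R zero (suc j) → ∃ λ i → R zero (suc i) × Star Bypass i j
    fromZero (_◅_ {j = zero}  _ rs) = fromZero rs
    fromZero (_◅_ {j = suc i} r rs) = i , r , Star⇒Bypass rs

  toZero : ∀ {i} → Star R (suc i) zero → ∃ λ j → Star Bypass i j × R (suc j) zero
  toZero (_◅_ {j = zero}  r _)  = _ , ε , r
  toZero (_◅_ {j = suc _} r rs) with toZero rs
  ... | j , ss , s = j , inj₁ r ◅ ss , s

star? : ∀ {m} {R : Rel (Fin m) 0ℓ} → Decidable R → Decidable (Star R)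
star? {suc m} {R} R? = go
  where
  bypass? : Decidable (Star (Bypass R))
  bypass? = star? λ i j →
    R? (suc i) (suc j) ⊎-dec (R? (suc i) zero ×-dec R? zero (suc j))

  go : Decidable (Star R)
  go zero    zero    = yes ε
  go zero    (suc j) = map′ (λ (_ , r , rs) → r ◅ Bypass⇒Star R rs) (fromZero R)
                            (Fin.any? λ i → R? zero (suc i) ×-dec bypass? i j)
  go (suc i) zero    = map′ (λ (_ , rs , r) → Bypass⇒Star R rs ◅◅ (r ◅ ε)) (toZero R)
                            (Fin.any? λ j → bypass? i j ×-dec R? (suc j) zero)
  go (suc i) (suc j) = map′ (Bypass⇒Star R) (Star⇒Bypass R) (bypass? i j)

module _ {n : ℕ} where

  adjacent? : Decidable (Adjacent {n})
  adjacent? x y =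
    (row {n} x ℕ.≟ row {n} y ×-dec ∣ column {n} x - column {n} y ∣ ℕ.≟ 1) ⊎-dec
    (column {n} x ℕ.≟ column {n} y ×-dec ∣ row {n} x - row {n} y ∣ ℕ.≟ 1)

  connected? : ∀ S → Dec (Connected {n} S)
  connected? S = Fin.all? λ x → Fin.all? λ y → x ∈? S →-dec (y ∈? S →-dec
    star? (λ u v → u ∈? S ×-dec (v ∈? S ×-dec adjacent? u v)) x y)

  piece? : ∀ S → Dec (Piece {n} S)
  piece? S = nonempty? S ×-dec connected? S

  division? : ∀ F → Dec (Division {n} F)
  division? F = All.all? piece? F
          ×-dec (AllPairs.allPairs? (λ S T → ¬? (nonempty? (S ∩ T))) F
          ×-dec Fin.all? (λ x → Any.any? (x ∈?_) F))

  divisionInto? : ∀ k F → Dec (DivisionInto {n} k F)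
  divisionInto? k F = length F ℕ.≟ k ×-dec division? F

  rightmost? : ∀ x → Dec (Rightmost {n} x)
  rightmost? x = suc (column {n} x) ℕ.≟ n

  rightmostApart? : ∀ F → Dec (RightmostApart {n} F)
  rightmostApart? F = Fin.all? λ x → Fin.all? λ y →
    rightmost? x →-dec (rightmost? y →-dec (¬? (x Fin.≟ y) →-dec
    ¬? (Any.any? (λ S → x ∈? S ×-dec y ∈? S) F)))

-- A set of subsets is represented by the sublist of its members in the
-- duplicate-free list of all subsets, so every such set occurs exactly once
-- in `families`, and the lengths below count set partitions (unordered).

allSubsets : ∀ m → List (Subset m)
allSubsets zero    = [] ∷ []
allSubsets (suc m) = map (outside ∷_) (allSubsets m) ++ map (inside ∷_) (allSubsets m)

sublists : ∀ {A : Set} → List A → List (List A)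
sublists []       = [] ∷ []
sublists (x ∷ xs) = sublists xs ++ map (x ∷_) (sublists xs)

families : ∀ n → List (List (Subset (n * 2)))
families n = sublists (allSubsets (n * 2))

d : ℕ → ℕ → ℕ
d k n = length (filter (divisionInto? {n} k) (families n))

s : ℕ → ℕ → ℕ
s k n = length (filter (λ F → divisionInto? {n} k F ×-dec rightmostApart? {n} F) (families n))

{-# OPTIONS --safe #-}
-- A division is determined by the set of edges of the grid that join squares of
-- the same piece.  Such edge sets are exactly those in which no 2 × 2 face has
-- precisely three of its four edges, because "same piece" is transitive and, on a
-- ladder, every longer cycle is controlled by its faces.  Hence a division of the
-- board with one more column is a division of the old board together with a filling
-- of the new face.  If the old rightmost squares x, y lie in one piece, the two new
-- squares form two new pieces, one new piece, one new piece beside a continuation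
-- (two ways), or both continue their rows; if x and y are apart, both new squares may
-- in addition join the piece of x, or both that of y.

module Submission where

open import Defs
open import Data.Bool using (Bool; true; false; if_then_else_)
import Data.Bool.Properties as 𝔹
open import Data.Fin using (Fin; zero; suc; toℕ; fromℕ<)
import Data.Fin.Properties as Fin
open import Data.Fin.Subset using (Subset) renaming (_∈_ to _∈ˢ_)
open import Data.Fin.Subset.Properties using (x∈p∩q⁺; x∈p∩q⁻; ⊆-antisym) renaming (_∈?_ to _∈ˢ?_)
open import Data.List using (List; []; _∷_; _++_; map; length; filter; upTo; concatMap)
open import Data.List.Properties using (filter-accept; filter-reject; length-map; length-upTo)
open import Data.List.Membership.Propositional using (_∈_; find; lose)
open import Data.List.Membership.Propositional.Properties
  using (∈-map⁺; ∈-map⁻; ∈-++⁺ˡ; ∈-++⁺ʳ; ∈-++⁻; ∈-filter⁺; ∈-filter⁻; ∈-upTo⁺; ∈-upTo⁻; ∈-concatMap⁺)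
open import Data.List.Membership.Propositional.Properties.WithK using (unique∧set⇒bag)
open import Data.List.Relation.Binary.BagAndSetEquality using (∼bag⇒↭)
open import Data.List.Relation.Binary.Permutation.Propositional.Properties using (↭-length)
open import Data.List.Relation.Unary.All as All using (All; []; _∷_)
import Data.List.Relation.Unary.All.Properties as All
open import Data.List.Relation.Unary.AllPairs as AllPairs using (AllPairs; []; _∷_)
import Data.List.Relation.Unary.AllPairs.Properties as AllPairs
open import Data.List.Relation.Unary.Any as Any using (Any; here; there)
open import Data.List.Relation.Unary.Unique.Propositional using (Unique)
import Data.List.Relation.Unary.Unique.Propositional.Properties as Unique
open import Data.Nat
open import Data.Nat.DivMod
open import Data.Nat.Divisibility using (divides)
open import Data.Nat.Properties
open import Data.Nat.Tactic.RingSolver using (solve-∀)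
open import Data.Product using (_×_; _,_; proj₁; proj₂; ∃)
open import Data.Product.Properties using (≡-dec)
open import Data.Sum using (_⊎_; inj₁; inj₂)
open import Data.Vec using ([]; _∷_; tabulate; lookup; here; there)
import Data.Vec.Properties as Vec
open import Function using (_∘_; _⇔_; mk⇔; Equivalence; case_of_)
open import Level using (0ℓ)
open import Relation.Binary using (Rel)
open import Relation.Binary.Construct.Closure.ReflexiveTransitive as Star using (Star; ε; _◅_; _◅◅_)
open import Relation.Binary.PropositionalEquality
open import Relation.Nullary using (¬_; Dec; yes; no; does; ¬?; contradiction; _×-dec_)
open import Relation.Nullary.Decidable using (dec-true; dec-false; does-⇔; from-yes)

-- Adjacency of squares on natural-number indices.

-- Unfolds to the same formula as `Adjacent` at the underlying numbers, but does not mention the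
-- number of columns, so one relation serves boards of all widths.
Adj : Rel ℕ 0ℓ
Adj i j = (i % 2 ≡ j % 2 × ∣ i / 2 - j / 2 ∣ ≡ 1)
        ⊎ (i / 2 ≡ j / 2 × ∣ i % 2 - j % 2 ∣ ≡ 1)

Adj-sym : ∀ {i j} → Adj i j → Adj j i
Adj-sym {i} {j} (inj₁ (p , q)) = inj₁ (sym p , trans (∣-∣-comm (j / 2) (i / 2)) q)
Adj-sym {i} {j} (inj₂ (p , q)) = inj₂ (sym p , trans (∣-∣-comm (j % 2) (i % 2)) q)

even/2 : ∀ c → c * 2 / 2 ≡ c
even/2 c = m*n/n≡m c 2

even%2 : ∀ c → c * 2 % 2 ≡ 0
even%2 c = m*n%n≡0 c 2

odd/2 : ∀ c → (1 + c * 2) / 2 ≡ c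
odd/2 c = trans (+-distrib-/-∣ʳ 1 {d = 2} (divides c refl)) (even/2 c)

odd%2 : ∀ c → (1 + c * 2) % 2 ≡ 1
odd%2 c = [m+kn]%n≡m%n 1 c 2

∣n-1+n∣≡1 : ∀ n → ∣ n - suc n ∣ ≡ 1
∣n-1+n∣≡1 zero    = refl
∣n-1+n∣≡1 (suc n) = ∣n-1+n∣≡1 n

Adj-top : ∀ c → Adj (c * 2) (suc c * 2)
Adj-top c = inj₁ (trans (even%2 c) (sym (even%2 (suc c))) ,
  trans (cong₂ ∣_-_∣ (even/2 c) (even/2 (suc c))) (∣n-1+n∣≡1 c))

Adj-bottom : ∀ c → Adj (1 + c * 2) (1 + suc c * 2)
Adj-bottom c = inj₁ (trans (odd%2 c) (sym (odd%2 (suc c))) ,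
  trans (cong₂ ∣_-_∣ (odd/2 c) (odd/2 (suc c))) (∣n-1+n∣≡1 c))

Adj-column : ∀ c → Adj (c * 2) (1 + c * 2)
Adj-column c = inj₂ (trans (even/2 c) (sym (odd/2 c)) , cong₂ ∣_-_∣ (even%2 c) (odd%2 c))

data Cell : ℕ → Set where
  top    : ∀ c → Cell (c * 2)
  bottom : ∀ c → Cell (1 + c * 2)

cell : ∀ i → Cell i
cell zero          = top 0
cell (suc zero)    = bottom 0
cell (suc (suc i)) with cell i
... | top c    = top (suc c)
... | bottom c = bottom (suc c)

-- Each edge is oriented from its smaller to its larger index. The cases are the top row, the bottom
-- row and a column, matching the three bits of a face.
Edge : Rel ℕ 0ℓ
Edge i j = (∃ λ c → i ≡ c * 2     × j ≡ suc c * 2)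
         ⊎ (∃ λ c → i ≡ 1 + c * 2 × j ≡ 1 + suc c * 2)
         ⊎ (∃ λ c → i ≡ c * 2     × j ≡ 1 + c * 2)

∣m-n∣≡1 : ∀ m n → ∣ m - n ∣ ≡ 1 → n ≡ suc m ⊎ m ≡ suc n
∣m-n∣≡1 zero    n       p = inj₁ p
∣m-n∣≡1 (suc m) zero    p = inj₂ p
∣m-n∣≡1 (suc m) (suc n) p with ∣m-n∣≡1 m n p
... | inj₁ q = inj₁ (cong suc q)
... | inj₂ q = inj₂ (cong suc q)

Adj⇒Edge : ∀ {i j} → Adj i j → Edge i j ⊎ Edge j i
Adj⇒Edge {i} {j} a with cell i | cell j
Adj⇒Edge (inj₁ (_ , q)) | top c | top e
  rewrite even/2 c | even/2 e with ∣m-n∣≡1 c e q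
... | inj₁ refl = inj₁ (inj₁ (c , refl , refl))
... | inj₂ refl = inj₂ (inj₁ (e , refl , refl))
Adj⇒Edge (inj₁ (_ , q)) | bottom c | bottom e
  rewrite odd/2 c | odd/2 e with ∣m-n∣≡1 c e q
... | inj₁ refl = inj₁ (inj₂ (inj₁ (c , refl , refl)))
... | inj₂ refl = inj₂ (inj₂ (inj₁ (e , refl , refl)))
Adj⇒Edge (inj₁ (p , _)) | top c | bottom e rewrite even%2 c | odd%2 e = case p of λ ()
Adj⇒Edge (inj₁ (p , _)) | bottom c | top e rewrite odd%2 c | even%2 e = case p of λ ()
Adj⇒Edge (inj₂ (_ , q)) | top c | top e rewrite even%2 c | even%2 e = case q of λ ()
Adj⇒Edge (inj₂ (_ , q)) | bottom c | bottom e rewrite odd%2 c | odd%2 e = case q of λ ()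
Adj⇒Edge (inj₂ (p , _)) | top c | bottom e rewrite even/2 c | odd/2 e | p =
  inj₁ (inj₂ (inj₂ (e , refl , refl)))
Adj⇒Edge (inj₂ (p , _)) | bottom c | top e rewrite odd/2 c | even/2 e | p =
  inj₂ (inj₂ (inj₂ (e , refl , refl)))

-- Labellings with connected classes.

Link : (D : ℕ → Set) (ℓ : ℕ → ℕ) → Rel ℕ 0ℓ
Link D ℓ i j = D i × D j × ℓ i ≡ ℓ j × Adj i j

-- A division of the squares in `D` with its pieces numbered: `onto` makes the pieces nonempty and
-- `linked` makes them connected. Since `ℓ` is defined on all of ℕ, a board grows by overwriting two
-- values.
record Labelling (D : ℕ → Set) (ℓ : ℕ → ℕ) (k : ℕ) : Set where
  field
    bounded : ∀ {i} → D i → ℓ i < k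
    onto    : ∀ {l} → l < k → ∃ λ i → D i × ℓ i ≡ l
    linked  : ∀ {i j} → D i → D j → ℓ i ≡ ℓ j → Star (Link D ℓ) i j

open Labelling

Link-sym : ∀ {D ℓ i j} → Link D ℓ i j → Link D ℓ j i
Link-sym {i = i} {j} (p , q , e , a) = q , p , sym e , Adj-sym {i} {j} a

Labelling-resp : ∀ {D E ℓ m k} → (∀ {i} → D i → E i) → (∀ {i} → E i → D i) →
                 (∀ i → ℓ i ≡ m i) → Labelling D ℓ k → Labelling E m k
Labelling-resp {D} {E} {ℓ} {m} D⇒E E⇒D eq L = record
  { bounded = λ p → subst (_< _) (eq _) (bounded L (E⇒D p))
  ; onto    = λ l<k → let i , p , e = onto L l<k in i , D⇒E p , trans (sym (eq i)) e
  ; linked  = λ p q e → Star.map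
      (λ (p , q , e , a) → D⇒E p , D⇒E q , trans (sym (eq _)) (trans e (eq _)) , a)
      (linked L (E⇒D p) (E⇒D q) (trans (eq _) (trans e (sym (eq _)))))
  }

infixl 6 _[_≔_]

_[_≔_] : (ℕ → ℕ) → ℕ → ℕ → ℕ → ℕ
(ℓ [ p ≔ a ]) i = if does (i ≟ p) then a else ℓ i

≔-new : ∀ ℓ p {a} → (ℓ [ p ≔ a ]) p ≡ a
≔-new ℓ p rewrite dec-true (p ≟ p) refl = refl

≔-old : ∀ ℓ {p a i} → i ≢ p → (ℓ [ p ≔ a ]) i ≡ ℓ i
≔-old ℓ {p} {a} {i} i≢p rewrite dec-false (i ≟ p) i≢p = refl

module _ {D : ℕ → Set} {ℓ : ℕ → ℕ} {k p : ℕ} (L : Labelling D ℓ k) (p∉D : ¬ D p) where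

  private
    D′ : ℕ → Set
    D′ i = D i ⊎ i ≡ p

    old : ∀ {a i} → D i → (ℓ [ p ≔ a ]) i ≡ ℓ i
    old d = ≔-old ℓ λ { refl → p∉D d }

    star : ∀ {a i j} → D i → D j → (ℓ [ p ≔ a ]) i ≡ (ℓ [ p ≔ a ]) j →
           Star (Link D′ (ℓ [ p ≔ a ])) i j
    star di dj e = Star.map
      (λ (d , d′ , e , adj) → inj₁ d , inj₁ d′ , trans (old d) (trans e (sym (old d′))) , adj)
      (linked L di dj (trans (sym (old di)) (trans e (old dj))))

  -- By `bounded` no old square carries the label `k`, so `p` is a piece by itself and the old paths
  -- survive.
  fresh : Labelling D′ (ℓ [ p ≔ k ]) (suc k)
  fresh = record
    { bounded = λ { (inj₁ d)    → subst (_< suc k) (sym (old d)) (m<n⇒m<1+n (bounded L d))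
                  ; (inj₂ refl) → subst (_< suc k) (sym (≔-new ℓ p)) ≤-refl }
    ; onto    = onto′
    ; linked  = λ { (inj₁ d)    (inj₁ d′)   e → star d d′ e
                  ; (inj₁ d)    (inj₂ refl) e → contradiction (trans (sym (old d)) (trans e (≔-new ℓ p))) (<⇒≢ (bounded L d))
                  ; (inj₂ refl) (inj₁ d)    e → contradiction (trans (sym (old d)) (trans (sym e) (≔-new ℓ p))) (<⇒≢ (bounded L d))
                  ; (inj₂ refl) (inj₂ refl) e → ε }
    }
    where
    onto′ : ∀ {l} → l < suc k → ∃ λ i → D′ i × (ℓ [ p ≔ k ]) i ≡ l
    onto′ l<1+k with m≤n⇒m<n∨m≡n (≤-pred l<1+k)
    ... | inj₁ l<k  = let i , d , e = onto L l<k in i , inj₁ d , trans (old d) e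
    ... | inj₂ refl = p , inj₂ refl , ≔-new ℓ p

  -- The only new paths required have `p` as an end, and they can go through its neighbour `q`,
  -- which carries the same label.
  join : ∀ {a q} → D q → a ≡ ℓ q → Adj p q → Labelling D′ (ℓ [ p ≔ a ]) k
  join {a} {q} dq refl adj = record
    { bounded = λ { (inj₁ d)    → subst (_< k) (sym (old d)) (bounded L d)
                  ; (inj₂ refl) → subst (_< k) (sym (≔-new ℓ p)) (bounded L dq) }
    ; onto    = λ l<k → let i , d , e = onto L l<k in i , inj₁ d , trans (old d) e
    ; linked  = λ { (inj₁ d)    (inj₁ d′)   e → star d d′ e
                  ; (inj₁ d)    (inj₂ refl) e → star d dq (trans e (sym q≈p)) ◅◅ (Link-sym {ℓ = ℓ [ p ≔ a ]} {p} {q} p→q ◅ ε)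
                  ; (inj₂ refl) (inj₁ d)    e → p→q ◅ star dq d (trans q≈p e)
                  ; (inj₂ refl) (inj₂ refl) e → ε }
    }
    where
    q≈p : (ℓ [ p ≔ a ]) q ≡ (ℓ [ p ≔ a ]) p
    q≈p = trans (old dq) (sym (≔-new ℓ p))

    p→q : Link D′ (ℓ [ p ≔ a ]) p q
    p→q = inj₂ refl , inj₁ dq , sym q≈p , adj

-- Codes of edge sets and the labellings built from them.

-- The three new edges of a face: top horizontal, bottom horizontal, right vertical.
Bits : Set
Bits = Bool × Bool × Bool

-- Edge sets of the board with suc n columns.
Code : ℕ → Set
Code zero    = Bool
Code (suc n) = Code n × Bits

-- The number of pieces lying wholly in the new column: horizontal edges tie a new square to an old
-- piece, possibly through the other new square.
weight : Bits → ℕ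
weight (false , false , false) = 2
weight (false , false , true)  = 1
weight (true  , false , false) = 1
weight (false , true  , false) = 1
weight (true  , true  , _)     = 0
weight (true  , false , true)  = 0
weight (false , true  , true)  = 0

-- Labels of the two new squares, where k is the first unused label and x, y are the
-- labels of the old rightmost squares.
topLabel bottomLabel : (k x y : ℕ) → Bits → ℕ
topLabel k x y (false , false , _)     = k
topLabel k x y (false , true  , false) = k
topLabel k x y (false , true  , true)  = y
topLabel k x y (true  , _     , _)     = x

bottomLabel k x y (false , false , false) = suc k
bottomLabel k x y (false , false , true)  = k
bottomLabel k x y (true  , false , false) = k
bottomLabel k x y (true  , false , true)  = x
bottomLabel k x y (_     , true  , _)     = y

extend : ℕ → (ℕ → ℕ) → ℕ → Bits → ℕ → ℕ
extend n ℓ k b = ℓ [ suc n * 2     ≔ topLabel    k (ℓ (n * 2)) (ℓ (1 + n * 2)) b ]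
                   [ 1 + suc n * 2 ≔ bottomLabel k (ℓ (n * 2)) (ℓ (1 + n * 2)) b ]

pieces : ∀ n → Code n → ℕ
pieces zero    true    = 1
pieces zero    false   = 2
pieces (suc n) (c , b) = weight b + pieces n c

label : ∀ n → Code n → ℕ → ℕ
label zero    true    i = 0
-- The identity gives the two squares of the only column the labels 0 and 1.
label zero    false   i = i
label (suc n) (c , b)   = extend n (label n c) (pieces n c) b

≔-comm : ∀ ℓ {p q a b} → p ≢ q → ∀ i → (ℓ [ p ≔ a ] [ q ≔ b ]) i ≡ (ℓ [ q ≔ b ] [ p ≔ a ]) i
≔-comm ℓ {p} {q} p≢q i with i ≟ p | i ≟ q
... | yes refl | _        = trans (≔-old (ℓ [ p ≔ _ ]) p≢q) (trans (≔-new ℓ p) (sym (≔-new (ℓ [ q ≔ _ ]) p)))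
... | no i≢p   | yes refl = trans (≔-new (ℓ [ p ≔ _ ]) q) (sym (trans (≔-old (ℓ [ q ≔ _ ]) i≢p) (≔-new ℓ q)))
... | no i≢p   | no i≢q   = trans (trans (≔-old (ℓ [ p ≔ _ ]) i≢q) (≔-old ℓ i≢p))
                              (sym (trans (≔-old (ℓ [ q ≔ _ ]) i≢p) (≔-old ℓ i≢q)))

-- Extending a labelling by one column.

module _ {n : ℕ} {ℓ : ℕ → ℕ} {k : ℕ} (L : Labelling (_< suc n * 2) ℓ k) where

  private
    -- The old rightmost squares are `m` and `1 + m`; the new ones are `t` in the top row and `u` in
    -- the bottom row.
    m t u : ℕ
    m = n * 2
    t = 2 + m
    u = 3 + m

    m<t : m < t
    m<t = m<n⇒m<1+n ≤-refl

    t≢u : t ≢ u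
    t≢u = <⇒≢ ≤-refl

    u≢t : u ≢ t
    u≢t = >⇒≢ ≤-refl

    D₁ : ℕ → Set
    D₁ i = i < t ⊎ i ≡ t

    u∉D₁ : ¬ D₁ u
    u∉D₁ (inj₁ p) = contradiction (<-trans ≤-refl p) (<-irrefl refl)
    u∉D₁ (inj₂ p) = u≢t p

    t→u : ∀ {i} → D₁ i ⊎ i ≡ u → i < 2 + t
    t→u (inj₁ (inj₁ p))    = m<n⇒m<1+n (m<n⇒m<1+n p)
    t→u (inj₁ (inj₂ refl)) = m<n⇒m<1+n ≤-refl
    t→u (inj₂ refl)        = ≤-refl

    u→t : ∀ {i} → i < 2 + t → D₁ i ⊎ i ≡ u
    u→t p with m≤n⇒m<n∨m≡n (≤-pred p)
    ... | inj₂ e = inj₂ e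
    ... | inj₁ q with m≤n⇒m<n∨m≡n (≤-pred q)
    ...   | inj₁ r = inj₁ (inj₁ r)
    ...   | inj₂ e = inj₁ (inj₂ e)

    D₂ : ℕ → Set
    D₂ i = i < t ⊎ i ≡ u

    t∉D : ¬ (t < t)
    t∉D = <-irrefl refl

    u∉D : ¬ (u < t)
    u∉D p = contradiction (<-trans ≤-refl p) (<-irrefl refl)

    t∉D₂ : ¬ D₂ t
    t∉D₂ (inj₁ p) = t∉D p
    t∉D₂ (inj₂ p) = t≢u p

    T-t : Adj t m
    T-t = Adj-sym {m} {t} (Adj-top n)

    B-u : Adj u (1 + m)
    B-u = Adj-sym {1 + m} {u} (Adj-bottom n)

    u-t : Adj u t
    u-t = Adj-sym {t} {u} (Adj-column (suc n))

    old₁ : ∀ {a i} → i < t → ℓ i ≡ (ℓ [ t ≔ a ]) i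
    old₁ p = sym (≔-old ℓ (<⇒≢ p))

    finish : ∀ {a b k′} → Labelling (λ i → D₁ i ⊎ i ≡ u) (ℓ [ t ≔ a ] [ u ≔ b ]) k′ →
             Labelling (_< 2 + t) (ℓ [ t ≔ a ] [ u ≔ b ]) k′
    finish = Labelling-resp t→u u→t (λ _ → refl)

    top-first : Labelling D₁ (ℓ [ t ≔ ℓ m ]) k
    top-first = join L t∉D m<t refl T-t

  -- The new squares are added one at a time by `fresh` or `join`, the top one first, so that the
  -- bottom one can join it along the column. In the last case the top square reaches the old board
  -- only through the bottom one, which must therefore come first.
  extend-Labelling : ∀ b → Labelling (_< 2 + t) (extend n ℓ k b) (weight b + k)
  extend-Labelling (false , false , false) = finish (fresh (fresh L t∉D) u∉D₁)
  extend-Labelling (false , false , true)  = finish (join (fresh L t∉D) u∉D₁ (inj₂ refl) (sym (≔-new ℓ t)) u-t)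
  extend-Labelling (true  , false , false) = finish (fresh top-first u∉D₁)
  extend-Labelling (true  , false , true)  = finish (join top-first u∉D₁ (inj₂ refl) (sym (≔-new ℓ t)) u-t)
  extend-Labelling (false , true  , false) = finish (join (fresh L t∉D) u∉D₁ (inj₁ ≤-refl) (old₁ ≤-refl) B-u)
  extend-Labelling (true  , true  , _)     = finish (join top-first u∉D₁ (inj₁ ≤-refl) (old₁ ≤-refl) B-u)
  extend-Labelling (false , true  , true)  =
    -- `≔-comm` restores the order in which `extend` makes its two updates.
    Labelling-resp swap (λ p → unswap (u→t p)) (≔-comm ℓ u≢t)
      (join (join L u∉D ≤-refl refl B-u) t∉D₂ (inj₂ refl) (sym (≔-new ℓ u)) (Adj-column (suc n)))
    where
    swap : ∀ {i} → D₂ i ⊎ i ≡ t → i < 2 + t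
    swap (inj₁ (inj₁ p)) = t→u (inj₁ (inj₁ p))
    swap (inj₁ (inj₂ p)) = t→u (inj₂ p)
    swap (inj₂ p)        = t→u (inj₁ (inj₂ p))

    unswap : ∀ {i} → D₁ i ⊎ i ≡ u → D₂ i ⊎ i ≡ t
    unswap (inj₁ (inj₁ p)) = inj₁ (inj₁ p)
    unswap (inj₁ (inj₂ p)) = inj₂ p
    unswap (inj₂ p)        = inj₁ (inj₂ p)

label-Labelling : ∀ n (c : Code n) → Labelling (_< suc n * 2) (label n c) (pieces n c)
label-Labelling (suc n) (c , b) = extend-Labelling {n} (label-Labelling n c) b
label-Labelling zero true = record
  { bounded = λ _ → s≤s z≤n
  ; onto    = λ { (s≤s z≤n) → 0 , s≤s z≤n , refl }
  ; linked  = star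
  }
  where
  star : ∀ {i j} → i < 2 → j < 2 → 0 ≡ 0 → Star (Link (_< 2) (label 0 true)) i j
  star {0}     {0}     p q e = ε
  star {0}     {1}     p q e = (p , q , e , Adj-column 0) ◅ ε
  star {1}     {0}     p q e = (p , q , e , Adj-sym {0} {1} (Adj-column 0)) ◅ ε
  star {1}     {1}     p q e = ε
  star {2+ _}          (s≤s (s≤s ())) q e
  star {0}     {2+ _}  p (s≤s (s≤s ())) e
  star {1}     {2+ _}  p (s≤s (s≤s ())) e
label-Labelling zero false = record
  { bounded = λ p → p
  ; onto    = λ p → _ , p , refl
  ; linked  = λ { _ _ refl → ε }
  }

-- The edge set of a labelling.

sameLabel : (ℕ → ℕ) → ℕ → ℕ → Bool
sameLabel ℓ i j = does (ℓ i ≟ ℓ j)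

-- An edge is present when its ends have equal labels; the label values themselves are forgotten.
trace : ∀ n → (ℕ → ℕ) → Code n
trace zero    ℓ = sameLabel ℓ 0 1
trace (suc n) ℓ = trace n ℓ , sameLabel ℓ (n * 2) (suc n * 2)
                , sameLabel ℓ (1 + n * 2) (1 + suc n * 2) , sameLabel ℓ (suc n * 2) (1 + suc n * 2)

-- The vertical edge of the last column, which is the left edge of the face added next.
side : ∀ n → Code n → Bool
side zero    v               = v
side (suc n) (_ , _ , _ , v) = v

side-trace : ∀ n ℓ → side n (trace n ℓ) ≡ sameLabel ℓ (n * 2) (1 + n * 2)
side-trace zero    ℓ = refl
side-trace (suc n) ℓ = refl

-- The fillings of a face with left edge v that do not give it exactly three edges.

extraMoves moves : Bool → List Bits
extraMoves true  = []
extraMoves false = (true , false , true) ∷ (false , true , true) ∷ []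

moves v = (false , false , false) ∷ (false , false , true) ∷ (true , false , false)
        ∷ (false , true , false) ∷ (true , true , v) ∷ extraMoves v

-- Enumerates, column by column, the edge sets in which no face has exactly three edges.
closed : ∀ n → List (Code n)
closed zero    = true ∷ false ∷ []
closed (suc n) = concatMap (λ c → map (c ,_) (moves (side n c))) (closed n)

-- Equality is transitive, so three equalities around a face force the fourth: these are the four
-- contradictory cases. Every other pattern is a listed filling.
face∈moves : ∀ {x y a b : ℕ} (p : Dec (x ≡ a)) (q : Dec (y ≡ b)) (r : Dec (a ≡ b)) (s : Dec (x ≡ y)) →
             (does p , does q , does r) ∈ moves (does s)
face∈moves (yes p) (yes q) (yes r) (yes s) = there (there (there (there (here refl))))
face∈moves (yes p) (yes q) (no r) (no s) = there (there (there (there (here refl))))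
face∈moves (yes p) (yes q) (yes r) (no s) = contradiction (trans p (trans r (sym q))) s
face∈moves (yes p) (yes q) (no r) (yes s) = contradiction (trans (sym p) (trans s q)) r
face∈moves (yes p) (no q) (yes r) (yes s) = contradiction (trans (sym s) (trans p r)) q
face∈moves (yes p) (no q) (yes r) (no s) = there (there (there (there (there (here refl)))))
face∈moves (no p) (yes q) (yes r) (yes s) = contradiction (trans s (trans q (sym r))) p
face∈moves (no p) (yes q) (yes r) (no s) = there (there (there (there (there (there (here refl))))))
face∈moves (yes p) (no q) (no r) _ = there (there (here refl))
face∈moves (no p) (yes q) (no r) _ = there (there (there (here refl)))
face∈moves (no p) (no q) (yes r) _ = there (here refl)
face∈moves (no p) (no q) (no r) _ = here refl

∈-closed : ∀ {n c b} → c ∈ closed n → b ∈ moves (side n c) → (c , b) ∈ closed (suc n)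
∈-closed {n} {c} c∈ b∈ = ∈-concatMap⁺ (λ c → map (c ,_) (moves (side n c))) (lose c∈ (∈-map⁺ (c ,_) b∈))

trace∈closed : ∀ n ℓ → trace n ℓ ∈ closed n
trace∈closed zero    ℓ with sameLabel ℓ 0 1
... | true  = here refl
... | false = there (here refl)
trace∈closed (suc n) ℓ = ∈-closed (trace∈closed n ℓ) (subst (λ v → proj₂ (trace (suc n) ℓ) ∈ moves v) (sym (side-trace n ℓ))
  (face∈moves (ℓ (n * 2) ≟ ℓ (suc n * 2)) (ℓ (1 + n * 2) ≟ ℓ (1 + suc n * 2))
              (ℓ (suc n * 2) ≟ ℓ (1 + suc n * 2)) (ℓ (n * 2) ≟ ℓ (1 + n * 2))))

sameLabel-cong : ∀ {ℓ m i j} → (ℓ i ≡ ℓ j ⇔ m i ≡ m j) → sameLabel ℓ i j ≡ sameLabel m i j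
sameLabel-cong {ℓ} {m} {i} {j} e = does-⇔ e (ℓ i ≟ ℓ j) (m i ≟ m j)

trace-cong : ∀ n {ℓ m} → (∀ {i j} → i < suc n * 2 → j < suc n * 2 → ℓ i ≡ ℓ j ⇔ m i ≡ m j) →
             trace n ℓ ≡ trace n m
trace-cong zero    {ℓ} {m} e = sameLabel-cong {ℓ} {m} (e (s≤s z≤n) (s≤s (s≤s z≤n)))
trace-cong (suc n) {ℓ} {m} e =
  cong₂ _,_ (trace-cong n λ p q → e (m≤n⇒m≤o+n 2 p) (m≤n⇒m≤o+n 2 q))
  (cong₂ _,_ (sameLabel-cong {ℓ} {m} (e (m≤n+m _ 3) (m≤n+m _ 1)))
  (cong₂ _,_ (sameLabel-cong {ℓ} {m} (e (m≤n+m _ 2) ≤-refl)) (sameLabel-cong {ℓ} {m} (e (m≤n+m _ 1) ≤-refl))))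

-- Recovering a closed edge set from its labelling.

≟-refl : ∀ i → does (i ≟ i) ≡ true
≟-refl i = dec-true (i ≟ i) refl

≢⇒≟ : ∀ {i j} → i ≢ j → does (i ≟ j) ≡ false
≢⇒≟ {i} {j} = dec-false (i ≟ j)

face : (x y t u : ℕ) → Bits
face x y t u = does (x ≟ t) , does (y ≟ u) , does (t ≟ u)

face-≡ : ∀ {x y t u a b c} → does (x ≟ t) ≡ a → does (y ≟ u) ≡ b → does (t ≟ u) ≡ c →
         face x y t u ≡ (a , b , c)
face-≡ refl refl refl = refl

faces-moves : ∀ {k x y} → x < k → y < k →
              All (λ b → face x y (topLabel k x y b) (bottomLabel k x y b) ≡ b) (moves (does (x ≟ y)))
faces-moves {k} {x} {y} x<k y<k =
    face-≡ {x} {y} {k} {suc k} x≉k (≢⇒≟ (<⇒≢ (m<n⇒m<1+n y<k))) (≢⇒≟ {k} (<⇒≢ ≤-refl))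
  ∷ face-≡ {x} {y} {k} {k} x≉k y≉k (≟-refl k)
  ∷ face-≡ {x} {y} {x} {k} (≟-refl x) y≉k x≉k
  ∷ face-≡ {x} {y} {k} {y} x≉k (≟-refl y) (≢⇒≟ (>⇒≢ y<k))
  -- Both rows continue, so the right edge repeats the left one.
  ∷ face-≡ {x} {y} {x} {y} (≟-refl x) (≟-refl y) refl
  ∷ extra (x ≟ y)
  where
  x≉k : does (x ≟ k) ≡ false
  x≉k = ≢⇒≟ (<⇒≢ x<k)

  y≉k : does (y ≟ k) ≡ false
  y≉k = ≢⇒≟ (<⇒≢ y<k)

  extra : (p : Dec (x ≡ y)) → All (λ b → face x y (topLabel k x y b) (bottomLabel k x y b) ≡ b)
                                  (extraMoves (does p))
  extra (yes _)  = []
  extra (no x≢y) = face-≡ {x} {y} {x} {x} (≟-refl x) (≢⇒≟ (x≢y ∘ sym)) (≟-refl x)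
                 ∷ face-≡ {x} {y} {y} {y} (≢⇒≟ x≢y) (≟-refl y) (≟-refl y) ∷ []

extend-old : ∀ n ℓ k b {i} → i < suc n * 2 → extend n ℓ k b i ≡ ℓ i
extend-old n ℓ k b i<t =
  trans (≔-old (ℓ [ suc n * 2 ≔ topLabel k (ℓ (n * 2)) (ℓ (1 + n * 2)) b ]) (<⇒≢ (m<n⇒m<1+n i<t)))
        (≔-old ℓ (<⇒≢ i<t))

extend-top : ∀ n ℓ k b → extend n ℓ k b (suc n * 2) ≡ topLabel k (ℓ (n * 2)) (ℓ (1 + n * 2)) b
extend-top n ℓ k b =
  trans (≔-old (ℓ [ suc n * 2 ≔ topLabel k (ℓ (n * 2)) (ℓ (1 + n * 2)) b ]) (<⇒≢ {suc n * 2} ≤-refl))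
        (≔-new ℓ (suc n * 2))

extend-bottom : ∀ n ℓ k b → extend n ℓ k b (1 + suc n * 2) ≡ bottomLabel k (ℓ (n * 2)) (ℓ (1 + n * 2)) b
extend-bottom n ℓ k b = ≔-new (ℓ [ suc n * 2 ≔ topLabel k (ℓ (n * 2)) (ℓ (1 + n * 2)) b ]) (1 + suc n * 2)

trace-extend : ∀ n ℓ k b → trace (suc n) (extend n ℓ k b) ≡
  (trace n ℓ , face (ℓ (n * 2)) (ℓ (1 + n * 2)) (topLabel k (ℓ (n * 2)) (ℓ (1 + n * 2)) b)
                                                (bottomLabel k (ℓ (n * 2)) (ℓ (1 + n * 2)) b))
trace-extend n ℓ k b
  rewrite extend-top n ℓ k b | extend-bottom n ℓ k b
        | extend-old n ℓ k b {n * 2} (m≤n+m _ 1) | extend-old n ℓ k b {1 + n * 2} ≤-refl =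
  cong (_, face (ℓ (n * 2)) (ℓ (1 + n * 2)) (topLabel k (ℓ (n * 2)) (ℓ (1 + n * 2)) b)
                                            (bottomLabel k (ℓ (n * 2)) (ℓ (1 + n * 2)) b))
    (trace-cong n {extend n ℓ k b} {ℓ} λ p q → mk⇔
      (λ e → trans (sym (extend-old n ℓ k b p)) (trans e (extend-old n ℓ k b q)))
      (λ e → trans (extend-old n ℓ k b p) (trans e (sym (extend-old n ℓ k b q)))))

-- An extension keeps the old labels, so the earlier bits return by induction and those of the last
-- face by `faces-moves`.
trace-label : ∀ n → All (λ c → trace n (label n c) ≡ c) (closed n)
trace-label zero    = refl ∷ refl ∷ []
trace-label (suc n) = All.concat⁺ (All.map⁺ (All.map (λ {c} → step c) (trace-label n)))
  where
  step : ∀ c → trace n (label n c) ≡ c →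
         All (λ c′ → trace (suc n) (label (suc n) c′) ≡ c′) (map (c ,_) (moves (side n c)))
  step c c≡ = All.map⁺ (All.map
    (λ {b} b≡ → trans (trace-extend n (label n c) (pieces n c) b) (cong₂ _,_ c≡ b≡))
    (subst (λ v → All (λ b → face T B (topLabel k T B b) (bottomLabel k T B b) ≡ b) (moves v)) side≡
      (faces-moves (bounded L (m≤n+m _ 1)) (bounded L ≤-refl))))
    where
    L = label-Labelling n c
    k = pieces n c
    T = label n c (n * 2)
    B = label n c (1 + n * 2)

    side≡ : does (T ≟ B) ≡ side n c
    side≡ = trans (sym (side-trace n (label n c))) (cong (side n) c≡)

-- The edge set determines the partition into label classes.

does⇒ : ∀ {A B : Set} {a? : Dec A} {b? : Dec B} → does a? ≡ does b? → A → B
does⇒ {a? = no ¬a} e a = contradiction a ¬a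
does⇒ {b? = yes b} e a = b
does⇒ {a? = yes _} {b? = no _} () a

module _ {ℓ m : ℕ → ℕ} where

  Agree : Rel ℕ 0ℓ
  Agree i j = sameLabel ℓ i j ≡ sameLabel m i j

  trace-edges : ∀ n → trace n ℓ ≡ trace n m →
    (∀ {c} → c < n → Agree (c * 2) (suc c * 2) × Agree (1 + c * 2) (1 + suc c * 2)) ×
    (∀ {c} → c < suc n → Agree (c * 2) (1 + c * 2))
  trace-edges zero    e = (λ ()) , λ { (s≤s z≤n) → e }
  trace-edges (suc n) e with trace-edges n (cong proj₁ e)
  ... | horizontal , vertical = horizontal′ , vertical′
    where
    horizontal′ : ∀ {c} → c < suc n → Agree (c * 2) (suc c * 2) × Agree (1 + c * 2) (1 + suc c * 2)
    horizontal′ c<1+n with m≤n⇒m<n∨m≡n (≤-pred c<1+n)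
    ... | inj₁ c<n  = horizontal c<n
    ... | inj₂ refl = cong (proj₁ ∘ proj₂) e , cong (proj₁ ∘ proj₂ ∘ proj₂) e

    vertical′ : ∀ {c} → c < 2 + n → Agree (c * 2) (1 + c * 2)
    vertical′ c<2+n with m≤n⇒m<n∨m≡n (≤-pred c<2+n)
    ... | inj₁ c<1+n = vertical c<1+n
    ... | inj₂ refl  = cong (proj₂ ∘ proj₂ ∘ proj₂) e

  agree : ∀ {i j} → Agree i j → ℓ i ≡ ℓ j → m i ≡ m j
  agree {i} {j} = does⇒ {a? = ℓ i ≟ ℓ j} {b? = m i ≟ m j}

  trace-Edge : ∀ n → trace n ℓ ≡ trace n m → ∀ {i j} → Edge i j → j < suc n * 2 → ℓ i ≡ ℓ j → m i ≡ m j
  trace-Edge n e (inj₁ (c , refl , refl)) q =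
    agree (proj₁ (proj₁ (trace-edges n e) (≤-pred (*-cancelʳ-< 2 (suc c) (suc n) q))))
  trace-Edge n e (inj₂ (inj₁ (c , refl , refl))) q =
    agree (proj₂ (proj₁ (trace-edges n e) (≤-pred (*-cancelʳ-< 2 (suc c) (suc n) (<-trans ≤-refl q)))))
  trace-Edge n e (inj₂ (inj₂ (c , refl , refl))) q =
    agree (proj₂ (trace-edges n e) (*-cancelʳ-< 2 c (suc n) (<-trans ≤-refl q)))

  -- A path inside one class of `ℓ` runs along edges of the common edge set, so `m` is constant on
  -- it. Connected classes of `ℓ` therefore lie inside classes of `m`.
  trace-kernel : ∀ n → trace n ℓ ≡ trace n m → ∀ {i j} → Star (Link (_< suc n * 2) ℓ) i j → m i ≡ m j
  trace-kernel n e ε = refl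
  trace-kernel n e (_◅_ {i} {j} (p , q , ℓ≡ , adj) steps) with Adj⇒Edge {i} {j} adj
  ... | inj₁ edge = trans (trace-Edge n e edge q ℓ≡) (trace-kernel n e steps)
  -- Here the path traverses an edge against its orientation.
  ... | inj₂ edge = trans (sym (trace-Edge n e edge p (sym ℓ≡))) (trace-kernel n e steps)

-- Sublists and lengths of duplicate-free lists.

module _ {A : Set} where

  sublist⊆ : ∀ {xs ys : List A} → ys ∈ sublists xs → ∀ {z} → z ∈ ys → z ∈ xs
  sublist⊆ {[]}     (here refl) ()
  sublist⊆ {x ∷ xs} ys∈ z∈ with ∈-++⁻ (sublists xs) ys∈
  ... | inj₁ ys∈′ = there (sublist⊆ ys∈′ z∈)
  ... | inj₂ ys∈′ with ∈-map⁻ (x ∷_) ys∈′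
  ...   | _ , zs∈ , refl with z∈
  ...     | here z≡x  = here z≡x
  ...     | there z∈′ = there (sublist⊆ zs∈ z∈′)

  sublists-unique : ∀ {xs : List A} → Unique xs → Unique (sublists xs)
  sublists-unique []           = [] ∷ []
  sublists-unique {x ∷ xs} u@(_ ∷ xs!) =
    Unique.++⁺ (sublists-unique xs!) (Unique.map⁺ (λ { refl → refl }) (sublists-unique xs!))
      λ { (p , q) → case ∈-map⁻ (x ∷_) q of λ
        { (_ , _ , refl) → Unique.Unique[x∷xs]⇒x∉xs u (sublist⊆ p (here refl)) } }

  module _ {P : A → Set} (P? : ∀ x → Dec (P x)) where

    filter∈sublists : ∀ xs → filter P? xs ∈ sublists xs
    filter∈sublists []       = here refl
    filter∈sublists (x ∷ xs) with does (P? x)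
    ... | false = ∈-++⁺ˡ (filter∈sublists xs)
    ... | true  = ∈-++⁺ʳ (sublists xs) (∈-map⁺ (x ∷_) (filter∈sublists xs))

    -- In a duplicate-free list a sublist is determined by its members, so equality in `families`
    -- can be proved by comparing membership.
    sublist≡filter : ∀ {xs ys} → Unique xs → ys ∈ sublists xs →
                     (∀ {x} → x ∈ xs → P x ⇔ x ∈ ys) → ys ≡ filter P? xs
    sublist≡filter {[]}     u (here refl) P⇔ = refl
    sublist≡filter {x ∷ xs} u@(_ ∷ xs!) ys∈ P⇔ with ∈-++⁻ (sublists xs) ys∈
    ... | inj₁ ys∈′ = trans (sublist≡filter xs! ys∈′ (P⇔ ∘ there))
      (sym (filter-reject P? λ px → Unique.Unique[x∷xs]⇒x∉xs u (sublist⊆ ys∈′ (Equivalence.to (P⇔ (here refl)) px))))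
    ... | inj₂ ys∈′ with ∈-map⁻ (x ∷_) ys∈′
    ...   | zs , zs∈ , refl = trans
      (cong (x ∷_) (sublist≡filter xs! zs∈ λ y∈ → mk⇔
        (λ py → tail y∈ (Equivalence.to (P⇔ (there y∈)) py))
        (λ y∈zs → Equivalence.from (P⇔ (there y∈)) (there y∈zs))))
      (sym (filter-accept P? (Equivalence.from (P⇔ (here refl)) (here refl))))
      where
      tail : ∀ {y} → y ∈ xs → y ∈ x ∷ zs → y ∈ zs
      tail y∈ (here refl) = contradiction y∈ (Unique.Unique[x∷xs]⇒x∉xs u)
      tail y∈ (there y∈′) = y∈′

  pairwise : ∀ {R : Rel A 0ℓ} {xs} → Unique xs → (∀ {x y} → x ∈ xs → y ∈ xs → x ≢ y → R x y) → AllPairs R xs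
  pairwise []         r = []
  pairwise (x∉ ∷ xs!) r = All.tabulate (λ y∈ → r (here refl) (there y∈) (All.lookup x∉ y∈))
                        ∷ pairwise xs! (λ x∈ y∈ → r (there x∈) (there y∈))

  unique-length : ∀ {xs ys : List A} → Unique xs → Unique ys → (∀ {z} → z ∈ xs ⇔ z ∈ ys) → length xs ≡ length ys
  unique-length xs! ys! e = ↭-length (∼bag⇒↭ (unique∧set⇒bag xs! ys! e))

map-unique : ∀ {A B : Set} (f : A → B) {xs} → Unique xs →
             (∀ {x y} → x ∈ xs → y ∈ xs → f x ≡ f y → x ≡ y) → Unique (map f xs)
map-unique f xs! inj = AllPairs.map⁺ (pairwise xs! λ x∈ y∈ x≢y → x≢y ∘ inj x∈ y∈)

bijection-length : ∀ {A B : Set} {xs : List A} {ys : List B} (f : A → B) (g : B → A) → Unique xs → Unique ys →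
  (∀ {x} → x ∈ xs → f x ∈ ys × g (f x) ≡ x) → (∀ {y} → y ∈ ys → g y ∈ xs × f (g y) ≡ y) → length xs ≡ length ys
bijection-length {xs = xs} {ys} f g xs! ys! to from = trans (sym (length-map f xs))
  (unique-length
    (map-unique f xs! λ x∈ y∈ e → trans (sym (proj₂ (to x∈))) (trans (cong g e) (proj₂ (to y∈)))) ys!
    (mk⇔ (λ z∈ → case ∈-map⁻ f z∈ of λ { (_ , x∈ , refl) → proj₁ (to x∈) })
         (λ y∈ → subst (_∈ map f xs) (proj₂ (from y∈)) (∈-map⁺ f (proj₁ (from y∈))))))

∈-allSubsets : ∀ {m} (S : Subset m) → S ∈ allSubsets m
∈-allSubsets []            = here refl
∈-allSubsets {suc m} (false ∷ S) = ∈-++⁺ˡ (∈-map⁺ (false ∷_) (∈-allSubsets S))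
∈-allSubsets {suc m} (true  ∷ S) = ∈-++⁺ʳ (map (false ∷_) (allSubsets m)) (∈-map⁺ (true ∷_) (∈-allSubsets S))

allSubsets-unique : ∀ m → Unique (allSubsets m)
allSubsets-unique zero    = [] ∷ []
allSubsets-unique (suc m) = Unique.++⁺
  (Unique.map⁺ (λ { refl → refl }) (allSubsets-unique m))
  (Unique.map⁺ (λ { refl → refl }) (allSubsets-unique m))
  λ (p , q) → case ∈-map⁻ _ p , ∈-map⁻ _ q of λ { ((_ , _ , refl) , (_ , _ , ())) }

subset-ext : ∀ {m} {S T : Subset m} → (∀ {x} → x ∈ˢ S ⇔ x ∈ˢ T) → S ≡ T
subset-ext e = ⊆-antisym (Equivalence.to e) (Equivalence.from e)

-- From families of subsets to piece indices.

-- False outside the board.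
has : ∀ {m} → Subset m → ℕ → Bool
has []      i       = false
has (b ∷ S) zero    = b
has (b ∷ S) (suc i) = has S i

∈⇒has : ∀ {m} {S : Subset m} {x} → x ∈ˢ S → has S (toℕ x) ≡ true
∈⇒has here       = refl
∈⇒has (there x∈) = ∈⇒has x∈

∉⇒has : ∀ {m} {S : Subset m} {x} → ¬ x ∈ˢ S → has S (toℕ x) ≡ false
∉⇒has {S = false ∷ S} {zero}  x∉ = refl
∉⇒has {S = true  ∷ S} {zero}  x∉ = contradiction here x∉
∉⇒has {S = b ∷ S}     {suc x} x∉ = ∉⇒has (x∉ ∘ there)

-- The position of the first member containing the square, with the length of the list as default.
-- Arguments in ℕ make it a function to which `trace` applies.
pieceIndex : ∀ {m} → List (Subset m) → ℕ → ℕ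
pieceIndex []      i = 0
pieceIndex (S ∷ F) i = if has S i then 0 else suc (pieceIndex F i)

Together : ∀ {m} → List (Subset m) → Rel (Fin m) 0ℓ
Together F x y = Any (λ S → x ∈ˢ S × y ∈ˢ S) F

module _ {n : ℕ} where

  meet : ∀ {S T : Subset (n * 2)} {x} → Disjoint {n} S T → x ∈ˢ S → ¬ x ∈ˢ T
  meet S#T x∈S x∈T = S#T (_ , x∈p∩q⁺ (x∈S , x∈T))

  Together⇒pieceIndex : ∀ {F x y} → AllPairs (Disjoint {n}) F → Together F x y →
                        pieceIndex F (toℕ x) ≡ pieceIndex F (toℕ y)
  Together⇒pieceIndex (_ ∷ _) (here (x∈ , y∈)) rewrite ∈⇒has x∈ | ∈⇒has y∈ = refl
  Together⇒pieceIndex {S ∷ F} {x} {y} (S# ∷ F#) (there xy) with find xy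
  ... | T , T∈ , x∈ , y∈
    rewrite ∉⇒has {S = S} {x} (λ x∈S → meet (All.lookup S# T∈) x∈S x∈)
          | ∉⇒has {S = S} {y} (λ y∈S → meet (All.lookup S# T∈) y∈S y∈) = cong suc (Together⇒pieceIndex F# xy)

  pieceIndex⇒Together : ∀ {F : List (Subset (n * 2))} {x y} → Any (x ∈ˢ_) F → Any (y ∈ˢ_) F →
                        pieceIndex F (toℕ x) ≡ pieceIndex F (toℕ y) → Together F x y
  pieceIndex⇒Together {S ∷ F} {x} {y} x∈F y∈F e with x ∈ˢ? S | y ∈ˢ? S
  ... | yes x∈ | yes y∈ = here (x∈ , y∈)
  ... | yes x∈ | no y∉ rewrite ∈⇒has x∈ | ∉⇒has y∉ = case e of λ ()
  ... | no x∉ | yes y∈ rewrite ∉⇒has x∉ | ∈⇒has y∈ = case e of λ ()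
  ... | no x∉ | no y∉ rewrite ∉⇒has x∉ | ∉⇒has y∉ =
    there (pieceIndex⇒Together (tail x∉ x∈F) (tail y∉ y∈F) (suc-injective e))
    where
    tail : ∀ {z} → ¬ z ∈ˢ S → Any (z ∈ˢ_) (S ∷ F) → Any (z ∈ˢ_) F
    tail z∉ (here z∈)   = contradiction z∈ z∉
    tail z∉ (there z∈F) = z∈F

  -- Disjointness makes the first piece containing a square its only one; covering rules out two
  -- squares sharing merely the default index.
  pieceIndex-≡ : ∀ {F x y} → Division {n} F → pieceIndex F (toℕ x) ≡ pieceIndex F (toℕ y) ⇔ Together F x y
  pieceIndex-≡ {F} {x} {y} (_ , F# , cover) =
    mk⇔ (pieceIndex⇒Together (cover x) (cover y)) (Together⇒pieceIndex F#)

  disjoint-≡ : ∀ {F : List (Subset (n * 2))} {S T x} → AllPairs (Disjoint {n}) F → S ∈ F → T ∈ F →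
               x ∈ˢ S → x ∈ˢ T → S ≡ T
  disjoint-≡ (_ ∷ _)   (here refl) (here refl) x∈S x∈T = refl
  disjoint-≡ (S# ∷ _)  (here refl) (there T∈)  x∈S x∈T = contradiction x∈T (meet (All.lookup S# T∈) x∈S)
  disjoint-≡ (T# ∷ _)  (there S∈)  (here refl) x∈S x∈T = contradiction x∈S (meet (All.lookup T# S∈) x∈T)
  disjoint-≡ (_ ∷ F#)  (there S∈)  (there T∈)  x∈S x∈T = disjoint-≡ F# S∈ T∈ x∈S x∈T

  Together-∈ : ∀ {F S x y} → Division {n} F → S ∈ F → x ∈ˢ S → y ∈ˢ S ⇔ Together F y x
  Together-∈ {F} {S} {x} {y} (_ , F# , _) S∈ x∈ = mk⇔ (λ y∈ → lose S∈ (y∈ , x∈))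
    λ yx → let T , T∈ , y∈ , x∈T = find yx in subst (y ∈ˢ_) (disjoint-≡ F# T∈ S∈ x∈T x∈) y∈

  -- From labellings to families of fibres.

  -- Opaque so that ℓ and l can be inferred from `fibre ℓ l`.
  opaque
    fibre : (ℕ → ℕ) → ℕ → Subset (n * 2)
    fibre ℓ l = tabulate λ x → does (ℓ (toℕ x) ≟ l)

    ∈-fibre : ∀ {ℓ l x} → x ∈ˢ fibre ℓ l ⇔ ℓ (toℕ x) ≡ l
    ∈-fibre {ℓ} {l} {x} = mk⇔ to from
      where
      lookup-fibre : lookup (fibre ℓ l) x ≡ does (ℓ (toℕ x) ≟ l)
      lookup-fibre = Vec.lookup∘tabulate _ x

      to : x ∈ˢ fibre ℓ l → ℓ (toℕ x) ≡ l
      to x∈ = does⇒ {A = l ≡ l} {a? = yes refl} {b? = ℓ (toℕ x) ≟ l} (trans (sym (Vec.[]=⇒lookup x∈)) lookup-fibre) refl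

      from : ℓ (toℕ x) ≡ l → x ∈ˢ fibre ℓ l
      from e = Vec.lookup⇒[]= x _ (trans lookup-fibre (dec-true (ℓ (toℕ x) ≟ l) e))

  fibres : (ℕ → ℕ) → ℕ → List (Subset (n * 2))
  fibres ℓ k = map (fibre ℓ) (upTo k)

  square : ∀ {i} → i < n * 2 → ∃ λ (x : Square n) → toℕ x ≡ i
  square p = fromℕ< p , Fin.toℕ-fromℕ< p

  -- Every step preserves the label, so the whole path stays in the fibre where it starts.
  lift-Star : ∀ {ℓ l i j x y} → toℕ x ≡ i → toℕ y ≡ j → ℓ i ≡ l → Star (Link (_< n * 2) ℓ) i j →
              Star (StepIn {n} (fibre ℓ l)) x y
  lift-Star refl e  i∈ ε with refl ← Fin.toℕ-injective e = ε
  lift-Star {ℓ} {l} {i} refl e i∈ (_◅_ {j = j} (_ , q , i≡j , adj) steps) with square q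
  ... | z , refl = (Equivalence.from ∈-fibre i∈ , Equivalence.from ∈-fibre (trans (sym i≡j) i∈) , adj)
                 ◅ lift-Star refl e (trans (sym i≡j) i∈) steps

  lower-Star : ∀ {F S x y} → Division {n} F → S ∈ F → Star (StepIn {n} S) x y →
               Star (Link (_< n * 2) (pieceIndex F)) (toℕ x) (toℕ y)
  lower-Star D S∈ = Star.gmap toℕ λ (x∈ , y∈ , adj) →
    Fin.toℕ<n _ , Fin.toℕ<n _ , Equivalence.from (pieceIndex-≡ D) (lose S∈ (x∈ , y∈)) , adj

  -- Two squares with equal index share a piece, whose connectedness supplies the path. This puts
  -- piece indices within reach of `trace-kernel`.
  pieceIndex-linked : ∀ {F x y} → Division {n} F → pieceIndex F (toℕ x) ≡ pieceIndex F (toℕ y) →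
                      Star (Link (_< n * 2) (pieceIndex F)) (toℕ x) (toℕ y)
  pieceIndex-linked D@(ps , _ , _) e =
    let S , S∈ , x∈ , y∈ = find (Equivalence.to (pieceIndex-≡ D) e)
    in lower-Star D S∈ (proj₂ (All.lookup ps S∈) _ _ x∈ y∈)

  module _ {ℓ k} (L : Labelling (_< n * 2) ℓ k) where

    label-< : ∀ (x : Square n) → ℓ (toℕ x) < k
    label-< x = bounded L (Fin.toℕ<n x)

    fibre-nonempty : ∀ {l} → l < k → ∃ λ x → x ∈ˢ fibre ℓ l
    fibre-nonempty l<k with onto L l<k
    ... | i , p , e with square p
    ...   | x , refl = x , Equivalence.from ∈-fibre e

    -- Each fibre contains a square, and the label of that square identifies the fibre.
    fibres-unique : Unique (fibres ℓ k)
    fibres-unique = map-unique (fibre ℓ) (Unique.upTo⁺ k) λ l∈ _ e →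
      let x , x∈ = fibre-nonempty (∈-upTo⁻ l∈)
      in trans (sym (Equivalence.to ∈-fibre x∈)) (Equivalence.to ∈-fibre (subst (x ∈ˢ_) e x∈))

    fibre∈fibres : ∀ x → fibre ℓ (ℓ (toℕ x)) ∈ fibres ℓ k
    fibre∈fibres x = ∈-map⁺ (fibre ℓ) (∈-upTo⁺ (label-< x))

    -- Families follow the order of `allSubsets` rather than that of the labels, so `F` is tied to
    -- the fibres by membership only.
    module _ {F} (F! : Unique F) (F⇔ : ∀ {S} → S ∈ F ⇔ S ∈ fibres ℓ k) where

      fibres-length : length F ≡ k
      fibres-length = trans (unique-length F! fibres-unique F⇔) (trans (length-map (fibre ℓ) (upTo k)) (length-upTo k))

      ∈-fibres : ∀ {S} → S ∈ F → ∃ λ l → l < k × S ≡ fibre ℓ l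
      ∈-fibres S∈ = let l , l∈ , e = ∈-map⁻ (fibre ℓ) (Equivalence.to F⇔ S∈) in l , ∈-upTo⁻ l∈ , e

      fibres-piece : ∀ {S} → S ∈ F → Piece {n} S
      fibres-piece S∈ with ∈-fibres S∈
      ... | l , l<k , refl = fibre-nonempty l<k , λ x y x∈ y∈ →
        let x≡l = Equivalence.to ∈-fibre x∈
        in lift-Star refl refl x≡l (linked L (Fin.toℕ<n x) (Fin.toℕ<n y) (trans x≡l (sym (Equivalence.to ∈-fibre y∈))))

      fibres-disjoint : ∀ {S T} → S ∈ F → T ∈ F → S ≢ T → Disjoint {n} S T
      fibres-disjoint S∈ T∈ S≢T (x , x∈) with ∈-fibres S∈ | ∈-fibres T∈
      ... | l , _ , refl | l′ , _ , refl = let x∈S , x∈T = x∈p∩q⁻ _ _ x∈ in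
        S≢T (cong (fibre ℓ) (trans (sym (Equivalence.to ∈-fibre x∈S)) (Equivalence.to ∈-fibre x∈T)))

      fibres-division : Division {n} F
      fibres-division = All.tabulate fibres-piece , pairwise F! fibres-disjoint ,
        λ x → lose (Equivalence.from F⇔ (fibre∈fibres x)) (Equivalence.from ∈-fibre refl)

      fibres-Together : ∀ {x y} → Together F x y ⇔ ℓ (toℕ x) ≡ ℓ (toℕ y)
      fibres-Together {x} {y} = mk⇔ to from
        where
        to : Together F x y → ℓ (toℕ x) ≡ ℓ (toℕ y)
        to xy with find xy
        ... | S , S∈ , x∈ , y∈ with ∈-fibres S∈
        ...   | l , _ , refl = trans (Equivalence.to ∈-fibre x∈) (sym (Equivalence.to ∈-fibre y∈))

        from : ℓ (toℕ x) ≡ ℓ (toℕ y) → Together F x y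
        from e = lose (Equivalence.from F⇔ (fibre∈fibres y)) (Equivalence.from ∈-fibre e , Equivalence.from ∈-fibre refl)

    -- The piece containing a square and the fibre of its label are its classes under one and the
    -- same equivalence relation.
    division-fibres : ∀ {F} → Division {n} F →
                      (∀ {x y} → pieceIndex F (toℕ x) ≡ pieceIndex F (toℕ y) ⇔ ℓ (toℕ x) ≡ ℓ (toℕ y)) →
                      ∀ {S} → S ∈ fibres ℓ k ⇔ S ∈ F
    division-fibres {F} D@(ps , _ , cover) e {S} = mk⇔ to from
      where
      piece≡fibre : ∀ {S x} → S ∈ F → x ∈ˢ S → S ≡ fibre ℓ (ℓ (toℕ x))
      piece≡fibre S∈ x∈ = subset-ext (mk⇔
        (λ y∈ → Equivalence.from ∈-fibre (Equivalence.to e (Equivalence.from (pieceIndex-≡ D) (Equivalence.to (Together-∈ D S∈ x∈) y∈))))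
        (λ y∈ → Equivalence.from (Together-∈ D S∈ x∈) (Equivalence.to (pieceIndex-≡ D) (Equivalence.from e (Equivalence.to ∈-fibre y∈)))))

      to : S ∈ fibres ℓ k → S ∈ F
      to S∈ with ∈-map⁻ (fibre ℓ) S∈
      ... | l , l∈ , refl with fibre-nonempty (∈-upTo⁻ l∈)
      ...   | x , x∈ with Equivalence.to ∈-fibre x∈
      ...     | refl = let T , T∈ , x∈T = find (cover x) in subst (_∈ F) (piece≡fibre T∈ x∈T) T∈

      from : S ∈ F → S ∈ fibres ℓ k
      from S∈ with All.lookup ps S∈
      ... | (x , x∈) , _ = subst (_∈ fibres ℓ k) (sym (piece≡fibre S∈ x∈)) (fibre∈fibres x)

-- Codes without repetition and their bijection with divisions.

unique? : (bs : List Bits) → Dec (Unique bs)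
unique? = AllPairs.allPairs? λ b b′ → ¬? (≡-dec 𝔹._≟_ (≡-dec 𝔹._≟_ 𝔹._≟_) b b′)

moves-unique : ∀ v → Unique (moves v)
moves-unique true  = from-yes (unique? (moves true))
moves-unique false = from-yes (unique? (moves false))

closed-unique : ∀ n → Unique (closed n)
closed-unique zero    = ((λ ()) ∷ []) ∷ [] ∷ []
closed-unique (suc n) = Unique.concat⁺
  (All.map⁺ (All.tabulate λ {c} _ → Unique.map⁺ (λ { refl → refl }) (moves-unique (side n c))))
  (AllPairs.map⁺ (AllPairs.map (λ {c} {c′} c≢c′ {_} (p , q) → case ∈-map⁻ (c ,_) p , ∈-map⁻ (c′ ,_) q of λ
    { ((_ , _ , refl) , (_ , _ , refl)) → c≢c′ refl }) (closed-unique n)))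

module _ (n : ℕ) where

  encode : List (Subset (suc n * 2)) → Code n
  encode F = trace n (pieceIndex F)

  codeFibres : Code n → List (Subset (suc n * 2))
  codeFibres c = fibres {suc n} (label n c) (pieces n c)

  fibre? : ∀ c S → Dec (S ∈ codeFibres c)
  fibre? c S = Any.any? (Vec.≡-dec 𝔹._≟_ S) (codeFibres c)

  -- Filtering `allSubsets` brings the fibres into the order that `families` uses.
  decode : Code n → List (Subset (suc n * 2))
  decode c = filter (fibre? c) (allSubsets (suc n * 2))

  decode-unique : ∀ c → Unique (decode c)
  decode-unique c = Unique.filter⁺ (fibre? c) (allSubsets-unique (suc n * 2))

  ∈-decode : ∀ c {S} → S ∈ decode c ⇔ S ∈ codeFibres c
  ∈-decode c = mk⇔ (proj₂ ∘ ∈-filter⁻ (fibre? c) {xs = allSubsets (suc n * 2)})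
                   (∈-filter⁺ (fibre? c) (∈-allSubsets _))

  decode-division : ∀ c → Division {suc n} (decode c)
  decode-division c = fibres-division (label-Labelling n c) (decode-unique c) (∈-decode c)

  decode-length : ∀ c → length (decode c) ≡ pieces n c
  decode-length c = fibres-length (label-Labelling n c) (decode-unique c) (∈-decode c)

  decode∈families : ∀ c → decode c ∈ families (suc n)
  decode∈families c = filter∈sublists (fibre? c) (allSubsets (suc n * 2))

  on-squares : ∀ {P : ℕ → ℕ → Set} → (∀ (x y : Square (suc n)) → P (toℕ x) (toℕ y)) →
               ∀ {i j} → i < suc n * 2 → j < suc n * 2 → P i j
  on-squares {P} f p q = subst₂ P (Fin.toℕ-fromℕ< p) (Fin.toℕ-fromℕ< q) (f (fromℕ< p) (fromℕ< q))

  -- Piece indices in the decoded family and the labels built from `c` induce the same partition, so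
  -- they have the same edge set, which is `c` because `c` is closed.
  encode-decode : ∀ {c} → c ∈ closed n → encode (decode c) ≡ c
  encode-decode {c} c∈ = trans
    (trace-cong n {pieceIndex (decode c)} {label n c}
      (on-squares {λ i j → pieceIndex (decode c) i ≡ pieceIndex (decode c) j ⇔ label n c i ≡ label n c j}
        λ x y → mk⇔
        (Equivalence.to (fibres-Together (label-Labelling n c) (decode-unique c) (∈-decode c))
          ∘ Equivalence.to (pieceIndex-≡ {suc n} (decode-division c)))
        (Equivalence.from (pieceIndex-≡ {suc n} (decode-division c))
          ∘ Equivalence.from (fibres-Together (label-Labelling n c) (decode-unique c) (∈-decode c)))))
    (All.lookup (trace-label n) c∈)

  -- The labels built from the code of `F` have the same edges as its piece indices. Both have
  -- connected classes, so `trace-kernel` in both directions makes the partitions equal.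
  decode-encode : ∀ {F} → F ∈ families (suc n) → Division {suc n} F → decode (encode F) ≡ F
  decode-encode {F} F∈ D = sym (sublist≡filter (fibre? c) (allSubsets-unique (suc n * 2)) F∈ λ _ →
    division-fibres {suc n} L D (mk⇔
      (λ e → trace-kernel n (sym trace≡) (pieceIndex-linked {suc n} D e))
      (λ e → trace-kernel n trace≡ (linked L (Fin.toℕ<n _) (Fin.toℕ<n _) e))))
    where
    c : Code n
    c = encode F

    L : Labelling (_< suc n * 2) (label n c) (pieces n c)
    L = label-Labelling n c

    trace≡ : trace n (label n c) ≡ trace n (pieceIndex F)
    trace≡ = All.lookup (trace-label n) (trace∈closed n (pieceIndex F))

  rightmost : ∀ (x : Square (suc n)) → Rightmost {suc n} x → toℕ x ≡ n * 2 ⊎ toℕ x ≡ 1 + n * 2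
  rightmost x r with toℕ x | cell (toℕ x)
  ... | _ | top c    = inj₁ (cong (_* 2) (trans (sym (even/2 c)) (suc-injective r)))
  ... | _ | bottom c = inj₂ (cong (λ c → 1 + c * 2) (trans (sym (odd/2 c)) (suc-injective r)))

  apart-side : ∀ {F} → Division {suc n} F → RightmostApart {suc n} F ⇔ side n (encode F) ≡ false
  apart-side {F} D = mk⇔ to from
    where
    T B : Square (suc n)
    T = fromℕ< (m≤n+m (suc (n * 2)) 1)
    B = fromℕ< {1 + n * 2} ≤-refl

    toℕ-T : toℕ T ≡ n * 2
    toℕ-T = Fin.toℕ-fromℕ< {n * 2} _

    toℕ-B : toℕ B ≡ 1 + n * 2
    toℕ-B = Fin.toℕ-fromℕ< {1 + n * 2} ≤-refl

    T-rightmost : Rightmost {suc n} T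
    T-rightmost = cong suc (trans (cong (_/ 2) toℕ-T) (even/2 n))

    B-rightmost : Rightmost {suc n} B
    B-rightmost = cong suc (trans (cong (_/ 2) toℕ-B) (odd/2 n))

    T≢B : T ≢ B
    T≢B e = <⇒≢ {n * 2} ≤-refl (trans (sym toℕ-T) (trans (cong toℕ e) toℕ-B))

    to : RightmostApart {suc n} F → side n (encode F) ≡ false
    to apart = trans (side-trace n (pieceIndex F)) (≢⇒≟ λ e →
      apart T B T-rightmost B-rightmost T≢B (Equivalence.to (pieceIndex-≡ {suc n} D)
        (trans (cong (pieceIndex F) toℕ-T) (trans e (cong (pieceIndex F) (sym toℕ-B))))))

    from : side n (encode F) ≡ false → RightmostApart {suc n} F
    from e x y rx ry x≢y xy with Equivalence.from (pieceIndex-≡ {suc n} D) xy | rightmost x rx | rightmost y ry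
    -- Rightmost squares of the same row coincide; only the mixed cases involve the vertical edge.
    ... | p | inj₁ i | inj₁ j = x≢y (Fin.toℕ-injective (trans i (sym j)))
    ... | p | inj₂ i | inj₂ j = x≢y (Fin.toℕ-injective (trans i (sym j)))
    ... | p | inj₁ i | inj₂ j rewrite i | j =
      contradiction (trans (sym e) (trans (side-trace n (pieceIndex F)) (dec-true (_ ≟ _) p))) λ ()
    ... | p | inj₂ i | inj₁ j rewrite i | j =
      contradiction (trans (sym e) (trans (side-trace n (pieceIndex F)) (dec-true (_ ≟ _) (sym p)))) λ ()

  module _ {P : List (Subset (suc n * 2)) → Set} {Q : Code n → Set}
           (P? : ∀ F → Dec (P F)) (Q? : ∀ c → Dec (Q c))
           (P⇒Division : ∀ {F} → P F → Division {suc n} F)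
           (P⇔Q : ∀ {F} → F ∈ families (suc n) → Division {suc n} F → P F ⇔ Q (encode F)) where

    -- `encode` and `decode` restrict to mutually inverse maps for any property of divisions visible
    -- on codes; this covers both `d` and `s`.
    count-codes : length (filter P? (families (suc n))) ≡ length (filter Q? (closed n))
    count-codes = bijection-length encode decode
      (Unique.filter⁺ P? (sublists-unique (allSubsets-unique (suc n * 2))))
      (Unique.filter⁺ Q? (closed-unique n))
      (λ F∈P → let F∈ , p = ∈-filter⁻ P? F∈P; D = P⇒Division p in
        ∈-filter⁺ Q? (trace∈closed n _) (Equivalence.to (P⇔Q F∈ D) p) , decode-encode F∈ D)
      (λ {c} c∈Q → let c∈ , q = ∈-filter⁻ Q? c∈Q in
        ∈-filter⁺ P? (decode∈families c)
          (Equivalence.from (P⇔Q (decode∈families c) (decode-division c)) (subst Q (sym (encode-decode c∈)) q))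
        , encode-decode c∈)

  length-pieces : ∀ {F} → F ∈ families (suc n) → Division {suc n} F → length F ≡ pieces n (encode F)
  length-pieces F∈ D = trans (cong length (sym (decode-encode F∈ D))) (decode-length _)

  d-codes : ∀ k → d k (suc n) ≡ length (filter (λ c → pieces n c ≟ k) (closed n))
  d-codes k = count-codes (divisionInto? {suc n} k) (λ c → pieces n c ≟ k) proj₂ λ F∈ D →
    mk⇔ (λ (e , _) → trans (sym (length-pieces F∈ D)) e) (λ e → trans (length-pieces F∈ D) e , D)

  s-codes : ∀ k → s k (suc n) ≡ length (filter (λ c → pieces n c ≟ k ×-dec side n c 𝔹.≟ false) (closed n))
  s-codes k = count-codes (λ F → divisionInto? {suc n} k F ×-dec rightmostApart? {suc n} F)
    (λ c → pieces n c ≟ k ×-dec side n c 𝔹.≟ false) (proj₂ ∘ proj₁) λ F∈ D → mk⇔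
      (λ ((e , _) , a) → trans (sym (length-pieces F∈ D)) e , Equivalence.to (apart-side D) a)
      (λ (e , a) → (trans (length-pieces F∈ D) e , D) , Equivalence.from (apart-side D) a)

-- Counting the fillings of the last face.

𝟙 : Bool → ℕ
𝟙 b = if b then 1 else 0

count : ∀ {A : Set} → (A → Bool) → List A → ℕ
count p []       = 0
count p (x ∷ xs) = 𝟙 (p x) + count p xs

count-++ : ∀ {A : Set} (p : A → Bool) xs ys → count p (xs ++ ys) ≡ count p xs + count p ys
count-++ p []       ys = refl
count-++ p (x ∷ xs) ys = trans (cong (𝟙 (p x) +_) (count-++ p xs ys)) (sym (+-assoc (𝟙 (p x)) _ _))

count-map : ∀ {A B : Set} (p : B → Bool) (f : A → B) xs → count p (map f xs) ≡ count (p ∘ f) xs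
count-map p f []       = refl
count-map p f (x ∷ xs) = cong (𝟙 (p (f x)) +_) (count-map p f xs)

length-filter≡count : ∀ {A : Set} {P : A → Set} (P? : ∀ x → Dec (P x)) xs →
                      length (filter P? xs) ≡ count (λ x → does (P? x)) xs
length-filter≡count P? []       = refl
length-filter≡count P? (x ∷ xs) with does (P? x)
... | true  = cong suc (length-filter≡count P? xs)
... | false = length-filter≡count P? xs

-- The fillings present for every `v` have weights 2, 1, 1, 1 and 0, which gives the coefficients 1,
-- 3 and 1. When `v` is false there are two more of weight 0, the source of the term in `s`.
count-moves : ∀ p k v → count (λ b → does (weight b + p ≟ 2 + k)) (moves v) ≡
  𝟙 (does (p ≟ k)) + 3 * 𝟙 (does (p ≟ suc k)) + 𝟙 (does (p ≟ 2 + k)) + 2 * 𝟙 (does (p ≟ 2 + k ×-dec v 𝔹.≟ false))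
-- With the left edge present the conjunction is false and its indicator vanishes.
count-moves p k true rewrite 𝔹.∧-zeroʳ (p ≡ᵇ 2 + k) =
  rearrange (𝟙 (p ≡ᵇ k)) (𝟙 (p ≡ᵇ suc k)) (𝟙 (p ≡ᵇ 2 + k))
  where
  rearrange : ∀ a b c → a + (b + (b + (b + (c + 0)))) ≡ a + 3 * b + c + 2 * 0
  rearrange = solve-∀
count-moves p k false rewrite 𝔹.∧-identityʳ (p ≡ᵇ 2 + k) =
  rearrange (𝟙 (p ≡ᵇ k)) (𝟙 (p ≡ᵇ suc k)) (𝟙 (p ≡ᵇ 2 + k))
  where
  rearrange : ∀ a b c → a + (b + (b + (b + (c + (c + (c + 0)))))) ≡ a + 3 * b + c + 2 * c
  rearrange = solve-∀

-- Sums the identity for a single face over all codes of the narrower board.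
count-extensions : ∀ n k (cs : List (Code n)) →
  count (λ c → does (pieces (suc n) c ≟ 2 + k)) (concatMap (λ c → map (c ,_) (moves (side n c))) cs) ≡
    count (λ c → does (pieces n c ≟ k)) cs + 3 * count (λ c → does (pieces n c ≟ suc k)) cs
    + count (λ c → does (pieces n c ≟ 2 + k)) cs
    + 2 * count (λ c → does (pieces n c ≟ 2 + k ×-dec side n c 𝔹.≟ false)) cs
count-extensions n k []       = refl
count-extensions n k (c ∷ cs) = begin
  count P (map (c ,_) (moves (side n c)) ++ concatMap (λ c → map (c ,_) (moves (side n c))) cs)
    ≡⟨ count-++ P (map (c ,_) (moves (side n c))) _ ⟩
  count P (map (c ,_) (moves (side n c))) + count P (concatMap (λ c → map (c ,_) (moves (side n c))) cs)
    ≡⟨ cong₂ _+_ (trans (count-map P (c ,_) (moves (side n c))) (count-moves (pieces n c) k (side n c)))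
                 (count-extensions n k cs) ⟩
  _ ≡⟨ regroup (𝟙 (does (pieces n c ≟ k))) (𝟙 (does (pieces n c ≟ suc k))) (𝟙 (does (pieces n c ≟ 2 + k))) (𝟙 (does (pieces n c ≟ 2 + k ×-dec side n c 𝔹.≟ false))) _ _ _
      (count (λ c → does (pieces n c ≟ 2 + k ×-dec side n c 𝔹.≟ false)) cs) ⟩
  _ ∎
  where
  open ≡-Reasoning

  P : Code (suc n) → Bool
  P c = does (pieces (suc n) c ≟ 2 + k)

  regroup : ∀ a b c e a′ b′ c′ e′ → (a + 3 * b + c + 2 * e) + (a′ + 3 * b′ + c′ + 2 * e′) ≡
            (a + a′) + 3 * (b + b′) + (c + c′) + 2 * (e + e′)
  regroup = solve-∀

theorem1 : (n k : ℕ) → 1 ≤ n → 2 ≤ k →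
    d k (n + 1) ≡ d (k ∸ 2) n + 3 * d (k ∸ 1) n + d k n + 2 * s k n
theorem1 (suc n) (suc (suc k)) (s≤s _) (s≤s (s≤s _)) = begin
  d (2 + k) (suc n + 1)
    ≡⟨ cong (d (2 + k)) (+-comm (suc n) 1) ⟩
  d (2 + k) (2 + n)
    -- The codes in `closed (suc n)` belong to the board with `2 + n` columns.
    ≡⟨ d-count (suc n) (2 + k) ⟩
  count (λ c → does (pieces (suc n) c ≟ 2 + k)) (closed (suc n))
    ≡⟨ count-extensions n k (closed n) ⟩
  count (λ c → does (pieces n c ≟ k)) (closed n) + 3 * count (λ c → does (pieces n c ≟ suc k)) (closed n)
    + count (λ c → does (pieces n c ≟ 2 + k)) (closed n)
    + 2 * count (λ c → does (pieces n c ≟ 2 + k ×-dec side n c 𝔹.≟ false)) (closed n)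
    ≡⟨ sym (cong₂ _+_ (cong₂ _+_ (cong₂ (λ a b → a + 3 * b) (d-count n k) (d-count n (suc k))) (d-count n (2 + k)))
                      (cong (2 *_) (trans (s-codes n (2 + k)) (length-filter≡count _ (closed n))))) ⟩
  d k (suc n) + 3 * d (suc k) (suc n) + d (2 + k) (suc n) + 2 * s (2 + k) (suc n) ∎
  where
  open ≡-Reasoning

  d-count : ∀ n k → d k (suc n) ≡ count (λ c → does (pieces n c ≟ k)) (closed n)
  d-count n k = trans (d-codes n k) (length-filter≡count (λ c → pieces n c ≟ k) (closed n))
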